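{- The powerset of the natural numbers under inclusion, $(\mathcal{P}(\omega),\subseteq)$, embeds (as a partial order) into $\mathsf{TLH}$. In particular, $\mathsf{TLH}$ has antichains and chains of size $2^{\aleph_0}$, and both its width and its height are exactly $2^{\aleph_0}$.
   Context: Fix a standard (acceptable) enumeration $(\varphi_e)_{e\in\omega}$ of the partial computable functions and let $W_e=\operatorname{dom}(\varphi_e)$. Write $e=^{\mathrm{ce}}e'$ iff $W_e=W_{e'}$. Let $\mathcal{R}^{\mathrm{ce}}$ be the set of all equivalence relations on $\omega$ extending $=^{\mathrm{ce}}$ (no definability or effectivity is assumed). An enumeration of a set $A$ is a surjection $\mu:\omega\to A$; $\mu[s]$ denotes the finite string $\mu(0),\dots,\mu(s-1)$. A learner is an arbitrary function $\mathbf{M}:\omega^{<\omega}\to\omega$ (no effectivity is assumed). For $E^{\mathrm{ce}}\in\mathcal{R}^{\mathrm{ce}}$, a family $\mathfrak{K}$ of nonempty c.e. sets is $E^{\mathrm{ce}}$-learnable if there is a learner $\mathbf{M}$ such that for every $e$ with $W_e\in\mathfrak{K}$ and every enumeration $\mu$ of $W_e$ there is $i\in\omega$ with $i\mathrel{E^{\mathrm{ce}}}e$ and $\mathbf{M}(\mu[s])=i$ for all sufficiently large $s$. $E^{\mathrm{ce}}\leq_{\mathrm{Learn}}F^{\mathrm{ce}}$ means that every $E^{\mathrm{ce}}$-learnable family of nonempty c.e. sets is also $F^{\mathrm{ce}}$-learnable; $E^{\mathrm{ce}}\equiv_{\mathrm{Learn}}F^{\mathrm{ce}}$ means both $E^{\mathrm{ce}}\leq_{\mathrm{Learn}}F^{\mathrm{ce}}$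 and $F^{\mathrm{ce}}\leq_{\mathrm{Learn}}E^{\mathrm{ce}}$. The tolerant learning hierarchy $\mathsf{TLH}$ is the poset $(\mathcal{E}^{\mathrm{ce}},\leq)$ where $\mathcal{E}^{\mathrm{ce}}=\mathcal{R}^{\mathrm{ce}}/{\equiv_{\mathrm{Learn}}}$ and $\leq$ is induced by $\leq_{\mathrm{Learn}}$. In a poset, a chain is a set of pairwise comparable elements and an antichain is a set of pairwise incomparable (distinct) elements. The height (respectively width) of a poset is the supremum of the cardinalities of its chains (respectively antichains). -}

module Defs where

open import Data.Bool.Base using (Bool)
open import Data.Fin.Base using (Fin)
open import Data.List.Base using (List; applyUpTo)
open import Data.Nat.Base using (ℕ; zero; suc; _≤_; _<_)
open import Data.Product.Base using (Σ; Σ-syntax; ∃; ∃-syntax; _×_; _,_; proj₁; proj₂)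
open import Data.Sum.Base using (_⊎_)
open import Data.Vec.Base using (Vec; []; _∷_; lookup)
open import Data.Vec.Relation.Binary.Pointwise.Inductive using (Pointwise)
open import Function.Base using (_∘_)
open import Function.Bundles using (_⇔_; Func; Injection; Surjection; Bijection)
open import Level using (Level; 0ℓ; _⊔_) renaming (suc to lsuc)
open import Relation.Binary.Bundles using (Setoid; Poset)
open import Relation.Binary.Core using (Rel)
open import Relation.Binary.Definitions using (_Respects_)
open import Relation.Binary.Morphism.Structures using (IsOrderMonomorphism)
open import Relation.Binary.PropositionalEquality using (_≡_; _→-setoid_)
open import Relation.Binary.Structures using (IsEquivalence)
open import Relation.Nullary.Negation.Core using (¬_)
open import Relation.Unary using (Pred; _∈_; _≐_; Satisfiable)
open import Relation.Unary.Relation.Binary.Subset using (⊆-poset)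
import Relation.Binary.Construct.Interior.Symmetric as Interior
import Relation.Binary.Construct.On as On

private
  variable
    a ℓ c ℓ₁ ℓ₂ c′ ℓ₁′ ℓ₂′ : Level

-- Sets are setoids, so surjections must split by maps that respect the
-- equality of the codomain.  This is choice in the sense of ZFC, not the
-- provable "intensional" axiom of choice for Σ-types.
AxiomOfChoice : ∀ a ℓ → Set (lsuc (a ⊔ ℓ))
AxiomOfChoice a ℓ = {S T : Setoid a ℓ} (f : Surjection S T) →
  Σ[ g ∈ Func T S ] (∀ y → Setoid._≈_ T (Surjection.to f (Func.to g y)) y)

------------------------------------------------------------------------
-- Partial computable functions

-- Kleene's μ-recursive functions.
data Rec : ℕ → Set where
  zeroᶠ   : ∀ {n} → Rec n
  sucᶠ    : Rec 1
  proj    : ∀ {n} → Fin n → Rec n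
  comp    : ∀ {m n} → Rec m → Vec (Rec n) m → Rec n
  primrec : ∀ {n} → Rec n → Rec (suc (suc n)) → Rec (suc n)
  search  : ∀ {n} → Rec (suc n) → Rec n

infix 4 _[_]⇓_

-- f [ xs ]⇓ y : the computation of f on xs halts with value y.
data _[_]⇓_ : ∀ {n} → Rec n → Vec ℕ n → ℕ → Set where
  zeroᶠ⇓   : ∀ {n} {xs : Vec ℕ n} → zeroᶠ [ xs ]⇓ 0
  sucᶠ⇓    : ∀ {x} → sucᶠ [ x ∷ [] ]⇓ suc x
  proj⇓    : ∀ {n} {i : Fin n} {xs} → proj i [ xs ]⇓ lookup xs i
  comp⇓    : ∀ {m n} {f : Rec m} {gs : Vec (Rec n) m} {xs ys z} →
             Pointwise (λ g y → g [ xs ]⇓ y) gs ys →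
             f [ ys ]⇓ z → comp f gs [ xs ]⇓ z
  primrec0 : ∀ {n} {f : Rec n} {g xs y} →
             f [ xs ]⇓ y → primrec f g [ 0 ∷ xs ]⇓ y
  primrecS : ∀ {n} {f : Rec n} {g xs k y z} →
             primrec f g [ k ∷ xs ]⇓ y → g [ k ∷ y ∷ xs ]⇓ z →
             primrec f g [ suc k ∷ xs ]⇓ z
  search⇓  : ∀ {n} {f : Rec (suc n)} {xs y} →
             (∀ z → z < y → ∃[ k ] f [ z ∷ xs ]⇓ suc k) →
             f [ y ∷ xs ]⇓ 0 → search f [ xs ]⇓ y

-- Graphs of a sequence of partial functions: φ e x y means φₑ(x) = y.
Numbering : Set₁
Numbering = ℕ → ℕ → ℕ → Set

-- A uniformly computable sequence into which every other uniformly
-- computable sequence ψₑ(x) = g(e, x) translates computably.  That every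
-- φ e is single-valued follows from `universal`, and that every unary
-- partial computable function occurs follows from `translate`.
record IsAcceptable (φ : Numbering) : Set where
  field
    universal : Σ[ u ∈ Rec 2 ] (∀ e x y → φ e x y ⇔ u [ e ∷ x ∷ [] ]⇓ y)
    translate : (g : Rec 2) → Σ[ s ∈ (ℕ → ℕ) ]
                  (Σ[ t ∈ Rec 1 ] (∀ e → t [ e ∷ [] ]⇓ s e)) ×
                  (∀ e x y → φ (s e) x y ⇔ g [ e ∷ x ∷ [] ]⇓ y)

------------------------------------------------------------------------
-- Learning

Enumerates : (ℕ → ℕ) → Pred ℕ 0ℓ → Set
Enumerates μ A = (∀ s → μ s ∈ A) × (∀ x → x ∈ A → ∃[ s ] μ s ≡ x)

Learner : Set
Learner = List ℕ → ℕ

module _ (φ : Numbering) where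

  W : ℕ → Pred ℕ 0ℓ
  W e x = ∃[ y ] φ e x y

  -- The set ℛᶜᵉ.
  record CERel : Set₁ where
    field
      _∼_           : Rel ℕ 0ℓ
      isEquivalence : IsEquivalence _∼_
      extends       : ∀ {e e′} → W e ≐ W e′ → e ∼ e′

  record Family : Set₁ where
    field
      Member   : Pred (Pred ℕ 0ℓ) 0ℓ
      resp     : Member Respects _≐_
      ce       : ∀ {A} → A ∈ Member → ∃[ e ] A ≐ W e
      nonempty : ∀ {A} → A ∈ Member → Satisfiable A

  Learnable : CERel → Family → Set
  Learnable E K = Σ[ M ∈ Learner ] (∀ e → W e ∈ Family.Member K →
    ∀ μ → Enumerates μ (W e) →
    ∃[ i ] (CERel._∼_ E i e × ∃[ s₀ ] (∀ s → s₀ ≤ s → M (applyUpTo μ s) ≡ i)))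

  _≤Learn_ : Rel CERel (lsuc 0ℓ)
  E ≤Learn F = ∀ K → Learnable E K → Learnable F K

  -- The quotient by ≡Learn is the poset whose underlying equality is the
  -- symmetric interior of ≤Learn.
  TLH : Poset (lsuc 0ℓ) (lsuc 0ℓ) (lsuc 0ℓ)
  TLH = Interior.poset {R = _≤Learn_}
    (λ _ p → p) (λ E≤F F≤G K → F≤G K ∘ E≤F K)

------------------------------------------------------------------------
-- Order embeddings, chains, antichains and cardinality

𝒫ω : Poset (lsuc 0ℓ) 0ℓ 0ℓ
𝒫ω = ⊆-poset ℕ 0ℓ

2^ℵ₀ : Setoid 0ℓ 0ℓ
2^ℵ₀ = ℕ →-setoid Bool

OrderEmbedding : Poset c ℓ₁ ℓ₂ → Poset c′ ℓ₁′ ℓ₂′ →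
                 Set (c ⊔ ℓ₁ ⊔ ℓ₂ ⊔ c′ ⊔ ℓ₁′ ⊔ ℓ₂′)
OrderEmbedding P Q = Σ[ f ∈ (P.Carrier → Q.Carrier) ]
  IsOrderMonomorphism P._≈_ Q._≈_ P._≤_ Q._≤_ f
  where
  module P = Poset P
  module Q = Poset Q

module _ (P : Poset c ℓ₁ ℓ₂) where
  open Poset P renaming (_≤_ to _⊑_)

  record Subset : Set (lsuc c ⊔ ℓ₁) where
    field
      Member : Pred Carrier c
      resp   : Member Respects _≈_

    asSetoid : Setoid c ℓ₁
    asSetoid = On.setoid Eq.setoid (proj₁ {B = Member})

  open Subset

  IsChain : Subset → Set (c ⊔ ℓ₂)
  IsChain A = ∀ {x y} → x ∈ Member A → y ∈ Member A → x ⊑ y ⊎ y ⊑ x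

  IsAntichain : Subset → Set (c ⊔ ℓ₁ ⊔ ℓ₂)
  IsAntichain A = ∀ {x y} → x ∈ Member A → y ∈ Member A →
    ¬ x ≈ y → ¬ (x ⊑ y ⊎ y ⊑ x)

  HasSize : Subset → Setoid a ℓ → Set (c ⊔ ℓ₁ ⊔ a ⊔ ℓ)
  HasSize A κ = Bijection κ (asSetoid A)

  -- κ is the supremum of the cardinalities of the subsets satisfying Q.
  -- Cardinals are compared by injections, so that κ is determined up to
  -- equinumerosity.
  IsSupOfSizes : ∀ {q} → (Subset → Set q) → Setoid a ℓ →
                 Set (lsuc c ⊔ lsuc ℓ₁ ⊔ q ⊔ a ⊔ ℓ)
  IsSupOfSizes Q κ =
    (∀ A → Q A → Injection (asSetoid A) κ) ×
    (∀ (ν : Setoid c ℓ₁) → (∀ A → Q A → Injection (asSetoid A) ν) → Injection κ ν)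

  IsHeight : Setoid a ℓ → Set (lsuc c ⊔ lsuc ℓ₁ ⊔ ℓ₂ ⊔ a ⊔ ℓ)
  IsHeight = IsSupOfSizes IsChain

  IsWidth : Setoid a ℓ → Set (lsuc c ⊔ lsuc ℓ₁ ⊔ ℓ₂ ⊔ a ⊔ ℓ)
  IsWidth = IsSupOfSizes IsAntichain

{-# OPTIONS --safe #-}

-- For X ⊆ ω let E_X relate e and e′ when W_e = W_e′, or when W_e and W_e′
-- have the same least element and it lies in X.  If X ⊆ Y then E_Y is coarser
-- than E_X, so E_X ≤ E_Y.  Conversely let K n be the family of all c.e. sets
-- with least element n.  If n ∈ X, a constant learner E_X-learns K n; if n ∉ Y,
-- then E_Y is the identity on K n, and K n contains Gold's unlearnable family
-- [n,n], [n,n+1], …, [n,∞).  Hence X ↦ E_X embeds 𝒫(ω).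
--
-- In 𝒫(2^{<ω}), the sets of prefixes of b ∈ 2^ω form an antichain, and the
-- lexicographic cuts {σ : σ ≤ b} form a chain.  Conversely TLH has at most 2^ℵ₀
-- elements because each is represented by a binary relation on ω.
module Submission where

open import Defs
open import Axiom.DoubleNegationElimination using (em⇒dne)
open import Axiom.ExcludedMiddle using (ExcludedMiddle)
open import Data.Bool.Base as Bool using (Bool; true; false; if_then_else_)
import Data.Bool.Properties as Bool
open import Data.Fin.Patterns using (0F; 1F; 2F)
open import Data.List.Base using (List; []; _∷_; _∷ʳ_; applyUpTo)
open import Data.List.Properties using (applyUpTo-∷ʳ)
open import Data.Nat.Base as ℕ
  using (ℕ; zero; _+_; _∸_; _⊔_; _≤_; _≤′_; ≤′-refl; ≤′-step)
open import Data.Nat.Binary.Base as ℕᵇ using (ℕᵇ; 2[1+_]; 1+[2_])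
open import Data.Nat.Binary.Properties using (fromℕ-toℕ)
open import Data.Nat.Properties
open import Data.Product.Base using (_×_; Σ-syntax; ∃-syntax; _,_; proj₁; proj₂)
open import Data.Sum.Base as Sum using (_⊎_; inj₁; inj₂)
open import Data.Unit.Base using (⊤; tt)
open import Data.Vec.Base using (Vec; []; _∷_)
open import Data.Vec.Relation.Binary.Pointwise.Inductive using (Pointwise; []; _∷_)
open import Function.Base using (_∘_; const; id)
open import Function.Bundles
  using (_⇔_; Equivalence; Func; Injection; Surjection; Bijection)
import Function.Construct.Composition as Comp
open import Level using (0ℓ; suc; Lift; lift; lower)
open import Relation.Binary.Bundles using (Setoid; Poset)
open import Relation.Binary.Construct.Interior.Symmetric using (_,_)
open import Relation.Binary.Definitions using (tri<; tri≈; tri>)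
open import Relation.Binary.PropositionalEquality
open import Relation.Nullary.Decidable.Core using (Dec; yes; no; does; map′)
open import Relation.Nullary.Negation.Core using (¬_; contradiction)
open import Relation.Unary using (Pred; _∈_; _∉_; _⊆_; _≐_)
open import Relation.Unary.Properties using (≐-refl; ≐-sym; ≐-trans)

lower-em : ExcludedMiddle (suc 0ℓ) → ExcludedMiddle 0ℓ
lower-em em {P} = map′ lower lift (em {Lift (suc 0ℓ) P})

-- Computability

mutual
  -- In the `search` case, if the two results differed, the body would take both the value zero and
  -- a successor at the smaller one.
  ⇓-deterministic : ∀ {n} {f : Rec n} {xs y z} → f [ xs ]⇓ y → f [ xs ]⇓ z → y ≡ z
  ⇓-deterministic zeroᶠ⇓ zeroᶠ⇓ = refl
  ⇓-deterministic sucᶠ⇓ sucᶠ⇓ = refl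
  ⇓-deterministic proj⇓ proj⇓ = refl
  ⇓-deterministic (comp⇓ gs f) (comp⇓ gs′ f′) with refl ← ⇓-deterministics gs gs′ =
    ⇓-deterministic f f′
  ⇓-deterministic (primrec0 f) (primrec0 f′) = ⇓-deterministic f f′
  ⇓-deterministic (primrecS r g) (primrecS r′ g′) with refl ← ⇓-deterministic r r′ =
    ⇓-deterministic g g′
  ⇓-deterministic (search⇓ {y = y} below at) (search⇓ {y = z} below′ at′)
    with <-cmp y z
  ... | tri≈ _ y≡z _ = y≡z
  ... | tri< y<z _ _ = contradiction (⇓-deterministic at (proj₂ (below′ y y<z))) λ ()
  ... | tri> _ _ z<y = contradiction (⇓-deterministic (proj₂ (below z z<y)) at′) λ ()

  ⇓-deterministics : ∀ {m n} {gs : Vec (Rec n) m} {xs : Vec ℕ n} {ys zs : Vec ℕ m} →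
    Pointwise (λ g y → g [ xs ]⇓ y) gs ys → Pointwise (λ g y → g [ xs ]⇓ y) gs zs → ys ≡ zs
  ⇓-deterministics [] [] = refl
  ⇓-deterministics (g ∷ gs) (g′ ∷ gs′) =
    cong₂ _∷_ (⇓-deterministic g g′) (⇓-deterministics gs gs′)

constᶠ : ∀ {n} → ℕ → Rec n
constᶠ zero      = zeroᶠ
constᶠ (ℕ.suc k) = comp sucᶠ (constᶠ k ∷ [])

constᶠ⇓ : ∀ {n} k {xs : Vec ℕ n} → constᶠ k [ xs ]⇓ k
constᶠ⇓ zero      = zeroᶠ⇓
constᶠ⇓ (ℕ.suc k) = comp⇓ (constᶠ⇓ k ∷ []) sucᶠ⇓

plusᶠ : Rec 2
plusᶠ = primrec (proj 0F) (comp sucᶠ (proj 1F ∷ []))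

plusᶠ⇓ : ∀ k x → plusᶠ [ k ∷ x ∷ [] ]⇓ (k + x)
plusᶠ⇓ zero      x = primrec0 proj⇓
plusᶠ⇓ (ℕ.suc k) x = primrecS (plusᶠ⇓ k x) (comp⇓ (proj⇓ ∷ []) sucᶠ⇓)

predᶠ : Rec 1
predᶠ = primrec zeroᶠ (proj 0F)

predᶠ⇓ : ∀ x → predᶠ [ x ∷ [] ]⇓ ℕ.pred x
predᶠ⇓ zero      = primrec0 zeroᶠ⇓
predᶠ⇓ (ℕ.suc x) = primrecS (predᶠ⇓ x) proj⇓

-- The subtrahend is the first argument: primrec recurses on that one.
monusᶠ : Rec 2
monusᶠ = primrec (proj 0F) (comp predᶠ (proj 1F ∷ []))

monusᶠ⇓ : ∀ k x → monusᶠ [ k ∷ x ∷ [] ]⇓ (x ∸ k)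
monusᶠ⇓ zero      x = primrec0 proj⇓
monusᶠ⇓ (ℕ.suc k) x = primrecS (monusᶠ⇓ k x)
  (comp⇓ (proj⇓ ∷ []) (subst (predᶠ [ x ∸ k ∷ [] ]⇓_) (pred[m∸n]≡m∸[1+n] x k) (predᶠ⇓ (x ∸ k))))

-- Rays and intervals as c.e. sets

Ray : ℕ → Pred ℕ 0ℓ
Ray n x = n ≤ x

Interval : ℕ → ℕ → Pred ℕ 0ℓ
Interval n m x = n ≤ x × x ≤ m

module _ {φ : Numbering} (acceptable : IsAcceptable φ) where
  open IsAcceptable acceptable

  -- The body of the search ignores the searched variable, so the search halts, at 0, exactly when
  -- `f` vanishes at `x`. It also ignores the parameter `e`, so the index `s 0` is an arbitrary
  -- choice among the `s e`.
  zeroSet-ce : (f : Rec 1) (F : ℕ → ℕ) → (∀ x → f [ x ∷ [] ]⇓ F x) →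
               ∃[ e ] (λ x → F x ≡ 0) ≐ W φ e
  zeroSet-ce f F f⇓F = s 0 , to , from
    where
    g : Rec 2
    g = search (comp f (proj 2F ∷ []))

    s : ℕ → ℕ
    s = proj₁ (translate g)

    s-index : ∀ e x y → φ (s e) x y ⇔ g [ e ∷ x ∷ [] ]⇓ y
    s-index = proj₂ (proj₂ (translate g))

    to : ∀ {x} → F x ≡ 0 → x ∈ W φ (s 0)
    to {x} Fx≡0 = 0 , Equivalence.from (s-index 0 x 0)
      (search⇓ (λ _ ()) (comp⇓ (proj⇓ ∷ []) (subst (f [ x ∷ [] ]⇓_) Fx≡0 (f⇓F x))))

    from : ∀ {x} → x ∈ W φ (s 0) → F x ≡ 0
    from {x} (y , φxy) with Equivalence.to (s-index 0 x y) φxy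
    ... | search⇓ _ (comp⇓ (proj⇓ ∷ []) fx⇓0) = ⇓-deterministic (f⇓F x) fx⇓0

  private
    rayᶠ : ℕ → Rec 1
    rayᶠ n = comp monusᶠ (proj 0F ∷ constᶠ n ∷ [])

    rayᶠ⇓ : ∀ n x → rayᶠ n [ x ∷ [] ]⇓ (n ∸ x)
    rayᶠ⇓ n x = comp⇓ (proj⇓ ∷ constᶠ⇓ n ∷ []) (monusᶠ⇓ x n)

  ray-ce : ∀ n → ∃[ e ] Ray n ≐ W φ e
  ray-ce n with zeroSet-ce (rayᶠ n) (n ∸_) (rayᶠ⇓ n)
  ... | e , Z≐W = e , ≐-trans (m≤n⇒m∸n≡0 , m∸n≡0⇒m≤n) Z≐W

  -- A sum of truncated differences vanishes exactly when each summand does, which turns the two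
  -- inequalities into a single zero set.
  interval-ce : ∀ n m → ∃[ e ] Interval n m ≐ W φ e
  interval-ce n m with zeroSet-ce
    (comp plusᶠ (rayᶠ n ∷ comp monusᶠ (constᶠ m ∷ proj 0F ∷ []) ∷ []))
    (λ x → (n ∸ x) + (x ∸ m))
    (λ x → comp⇓ (rayᶠ⇓ n x ∷ comp⇓ (constᶠ⇓ m ∷ proj⇓ ∷ []) (monusᶠ⇓ m x) ∷ [])
                 (plusᶠ⇓ (n ∸ x) (x ∸ m)))
  ... | e , Z≐W = e , ≐-trans (to , from) Z≐W
    where
    to : Interval n m ⊆ λ x → (n ∸ x) + (x ∸ m) ≡ 0
    to (n≤x , x≤m) = cong₂ _+_ (m≤n⇒m∸n≡0 n≤x) (m≤n⇒m∸n≡0 x≤m)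

    from : (λ x → (n ∸ x) + (x ∸ m) ≡ 0) ⊆ Interval n m
    from {x} eq = m∸n≡0⇒m≤n (m+n≡0⇒m≡0 (n ∸ x) eq) , m∸n≡0⇒m≤n (m+n≡0⇒n≡0 (n ∸ x) eq)

-- Gold's theorem

Enumerates-resp : ∀ {μ A B} → A ≐ B → Enumerates μ A → Enumerates μ B
Enumerates-resp (A⊆B , B⊆A) (into , onto) = A⊆B ∘ into , λ x → onto x ∘ B⊆A

module _ (V : ℕ → Pred ℕ 0ℓ) where

  -- Gold's identification in the limit: the final conjecture must be exactly correct.
  Identifies : Learner → Pred ℕ 0ℓ → Set
  Identifies M A = ∀ μ → Enumerates μ A →
    ∃[ i ] V i ≐ A × ∃[ s₀ ] (∀ s → s₀ ≤ s → M (applyUpTo μ s) ≡ i)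

  -- The text repeats its current value v until M conjectures [n, v], and then
  -- moves on to v + 1.  If it stops at v, then M fails on this enumeration of
  -- [n, v]; otherwise it enumerates [n, ∞) and M changes its mind forever.
  module _ (em : ExcludedMiddle 0ℓ) (M : Learner) (n : ℕ) where

    private
      next : List ℕ → ℕ → ℕ
      next σ v = if does (em {V (M σ) ≐ Interval n v}) then ℕ.suc v else v

      -- `history` carries the initial segment along with the recursion; a definition of `text`
      -- through `applyUpTo text` would not be structurally recursive.
      mutual
        history : ℕ → List ℕ
        history zero      = []
        history (ℕ.suc s) = history s ∷ʳ text s

        text : ℕ → ℕ
        text zero      = n
        text (ℕ.suc s) = next (history s ∷ʳ text s) (text s)

      history≡ : ∀ s → history s ≡ applyUpTo text s
      history≡ zero      = refl
      history≡ (ℕ.suc s) = trans (cong (_∷ʳ text s) (history≡ s)) (applyUpTo-∷ʳ text s)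

      -- The conjecture is tested only after `text s` itself has been read, hence the length
      -- `suc s`.
      Moves : ℕ → Set
      Moves s = V (M (applyUpTo text (ℕ.suc s))) ≐ Interval n (text s)

      text-suc : ∀ s → text (ℕ.suc s) ≡ next (applyUpTo text (ℕ.suc s)) (text s)
      text-suc s = cong (λ σ → next σ (text s)) (history≡ (ℕ.suc s))

      text-moves : ∀ s → Moves s → text (ℕ.suc s) ≡ ℕ.suc (text s)
      text-moves s m rewrite text-suc s with em {Moves s}
      ... | yes _ = refl
      ... | no ¬m = contradiction m ¬m

      text-stays : ∀ s → ¬ Moves s → text (ℕ.suc s) ≡ text s
      text-stays s ¬m rewrite text-suc s with em {Moves s}
      ... | yes m = contradiction m ¬m
      ... | no _ = refl

      text≤text-suc : ∀ s → text s ≤ text (ℕ.suc s)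
      text≤text-suc s with em {Moves s}
      ... | yes m = ≤-trans (n≤1+n _) (≤-reflexive (sym (text-moves s m)))
      ... | no ¬m = ≤-reflexive (sym (text-stays s ¬m))

      text-suc≤suc-text : ∀ s → text (ℕ.suc s) ≤ ℕ.suc (text s)
      text-suc≤suc-text s with em {Moves s}
      ... | yes m = ≤-reflexive (text-moves s m)
      ... | no ¬m = ≤-trans (≤-reflexive (text-stays s ¬m)) (n≤1+n _)

      text-mono′ : ∀ {s t} → s ≤′ t → text s ≤ text t
      text-mono′ ≤′-refl         = ≤-refl
      text-mono′ (≤′-step {t} s≤′t) = ≤-trans (text-mono′ s≤′t) (text≤text-suc t)

      text-mono : ∀ {s t} → s ≤ t → text s ≤ text t
      text-mono = text-mono′ ∘ ≤⇒≤′

      n≤text : ∀ s → n ≤ text s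
      n≤text s = text-mono {0} {s} ℕ.z≤n

      -- A discrete intermediate value argument: `text` starts at `n` and rises by at most one at
      -- each stage.
      text-attains : ∀ s {x} → n ≤ x → x ≤ text s → ∃[ t ] text t ≡ x
      text-attains zero      n≤x x≤n = 0 , ≤-antisym n≤x x≤n
      text-attains (ℕ.suc s) {x} n≤x x≤ with x ≤? text s
      ... | yes x≤text = text-attains s n≤x x≤text
      ... | no x≰text = ℕ.suc s , ≤-antisym (≤-trans (text-suc≤suc-text s) (≰⇒> x≰text)) x≤

      text-constant : ∀ {s t} → (∀ u → s ≤ u → ¬ Moves u) → s ≤′ t → text t ≡ text s
      text-constant stays ≤′-refl = refl
      text-constant stays (≤′-step {t} s≤′t) =
        trans (text-stays t (stays t (≤′⇒≤ s≤′t))) (text-constant stays s≤′t)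

      -- If the text never moved after stage `s`, it would enumerate the interval from `n` to
      -- `text s`. Then `M` would converge to an index of that interval, and this is exactly the
      -- condition for a move.
      moves-again : (∀ m → n ≤ m → Identifies M (Interval n m)) →
                    ∀ s → ¬ (∀ t → s ≤ t → ¬ Moves t)
      moves-again identifies s stays =
        let i , Vi≐ , s₀ , converges =
              identifies (text s) (n≤text s) text (into , λ _ (n≤x , x≤) → text-attains s n≤x x≤)
            -- A stage at which the text is already constant and `M` has already settled.
            t = s ⊔ s₀
        in stays t (m≤m⊔n s s₀) (subst₂ (λ j m → V j ≐ Interval n m)
             (sym (converges (ℕ.suc t) (m≤n⇒m≤1+n (m≤n⊔m s s₀))))
             (sym (text-constant stays (≤⇒≤′ (m≤m⊔n s s₀))))
             Vi≐)
        where
        into : ∀ t → text t ∈ Interval n (text s)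
        into t with ≤-total s t
        ... | inj₁ s≤t = n≤text t , ≤-reflexive (text-constant stays (≤⇒≤′ s≤t))
        ... | inj₂ t≤s = n≤text t , text-mono t≤s

    -- Moves recur forever, so `text` is unbounded and enumerates the ray. Once `M` has settled on
    -- an index of the ray, a further move at `t` would make the same index name the interval ending
    -- at `text t`, yet `suc (text t)` belongs to the ray.
    gold : Identifies M (Ray n) → ¬ (∀ m → n ≤ m → Identifies M (Interval n m))
    gold identifies-ray identifies =
      let i , Vi≐ , s₀ , converges = identifies-ray text (n≤text , onto)
          t , s₀≤t , moves , _ = moves-later s₀
          1+v∈Vi = proj₂ Vi≐ (m≤n⇒m≤1+n (n≤text t))
          i≡ = sym (converges (ℕ.suc t) (m≤n⇒m≤1+n s₀≤t))
      in 1+n≰n (proj₂ (moves (subst (λ j → ℕ.suc (text t) ∈ V j) i≡ 1+v∈Vi)))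
      where
      moves-later : ∀ s → ∃[ t ] s ≤ t × Moves t
      moves-later s = em⇒dne em λ never →
        moves-again identifies s λ t s≤t m → never (t , s≤t , m)

      unbounded : ∀ k → ∃[ s ] k ≤ text s
      unbounded zero = 0 , ℕ.z≤n
      unbounded (ℕ.suc k) with s , k≤ ← unbounded k with t , s≤t , m ← moves-later s =
        ℕ.suc t , ≤-trans (ℕ.s≤s (≤-trans k≤ (text-mono s≤t))) (≤-reflexive (sym (text-moves t m)))

      onto : ∀ x → n ≤ x → ∃[ s ] text s ≡ x
      onto x n≤x with s , x≤ ← unbounded x = text-attains s n≤x x≤

-- The embedding

IsLeast : ℕ → Pred ℕ 0ℓ → Set
IsLeast n A = n ∈ A × A ⊆ Ray n

IsLeast-resp : ∀ {n A B} → A ≐ B → IsLeast n A → IsLeast n B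
IsLeast-resp (A⊆B , B⊆A) (n∈A , n≤A) = A⊆B n∈A , n≤A ∘ B⊆A

IsLeast-unique : ∀ {m n A} → IsLeast m A → IsLeast n A → m ≡ n
IsLeast-unique (m∈A , m≤A) (n∈A , n≤A) = ≤-antisym (m≤A n∈A) (n≤A m∈A)

IsLeast-ray : ∀ n → IsLeast n (Ray n)
IsLeast-ray n = ≤-refl , id

IsLeast-interval : ∀ {n m} → n ≤ m → IsLeast n (Interval n m)
IsLeast-interval n≤m = (≤-refl , n≤m) , proj₁

module _ (φ : Numbering) where
  open CERel

  -- The same learner works, since a conjecture correct up to `E` is correct up to `F`.
  finer⇒≤Learn : ∀ E F → (∀ {e e′} → _∼_ E e e′ → _∼_ F e e′) → _≤Learn_ φ E F
  finer⇒≤Learn E F E⇒F K (M , learns) = M , λ e We∈K μ μ-enum →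
    let i , i∼e , converges = learns e We∈K μ μ-enum in i , E⇒F i∼e , converges

  mergeLeast : Pred ℕ 0ℓ → CERel φ
  mergeLeast X = record
    { _∼_           = _≈_
    ; isEquivalence = record { refl = inj₁ ≐-refl ; sym = ≈-sym ; trans = ≈-trans }
    ; extends       = inj₁
    }
    where
    _≈_ : ℕ → ℕ → Set
    e ≈ e′ = W φ e ≐ W φ e′ ⊎ (∃[ n ] n ∈ X × IsLeast n (W φ e) × IsLeast n (W φ e′))

    ≈-sym : ∀ {e e′} → e ≈ e′ → e′ ≈ e
    ≈-sym (inj₁ eq)                  = inj₁ (≐-sym eq)
    ≈-sym (inj₂ (n , n∈X , l , l′)) = inj₂ (n , n∈X , l′ , l)

    ≈-trans : ∀ {d e f} → d ≈ e → e ≈ f → d ≈ f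
    ≈-trans (inj₁ d≐e) (inj₁ e≐f) = inj₁ (≐-trans d≐e e≐f)
    ≈-trans (inj₁ d≐e) (inj₂ (n , n∈X , l , l′)) =
      inj₂ (n , n∈X , IsLeast-resp (≐-sym d≐e) l , l′)
    ≈-trans (inj₂ (n , n∈X , l , l′)) (inj₁ e≐f) =
      inj₂ (n , n∈X , l , IsLeast-resp e≐f l′)
    -- Both merges refer to the least element of the middle set, so `m` and `n` coincide.
    ≈-trans (inj₂ (m , m∈X , k , k′)) (inj₂ (n , n∈X , l , l′))
      with refl ← IsLeast-unique k′ l = inj₂ (m , m∈X , k , l′)

  mergeLeast-mono : ∀ {X Y} → X ⊆ Y → _≤Learn_ φ (mergeLeast X) (mergeLeast Y)
  mergeLeast-mono {X} {Y} X⊆Y = finer⇒≤Learn (mergeLeast X) (mergeLeast Y)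
    (Sum.map₂ λ (n , n∈X , ls) → n , X⊆Y n∈X , ls)

  leastFamily : ℕ → Family φ
  leastFamily n = record
    { Member   = λ A → (∃[ e ] A ≐ W φ e) × IsLeast n A
    ; resp     = λ A≐B ((e , A≐W) , l) →
                   (e , ≐-trans (≐-sym A≐B) A≐W) , IsLeast-resp A≐B l
    ; ce       = proj₁
    ; nonempty = λ (_ , n∈A , _) → n , n∈A
    }

  module _ (em : ExcludedMiddle 0ℓ) (acceptable : IsAcceptable φ) where

    leastFamily-learnable : ∀ {X n} → n ∈ X → Learnable φ (mergeLeast X) (leastFamily n)
    leastFamily-learnable {X} {n} n∈X with r , ray≐ ← ray-ce acceptable n =
      const r , λ e (_ , l) μ _ →
        r , inj₂ (n , n∈X , IsLeast-resp ray≐ (IsLeast-ray n) , l) , 0 , λ _ _ → refl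

    leastFamily-unlearnable : ∀ {Y n} → n ∉ Y → ¬ Learnable φ (mergeLeast Y) (leastFamily n)
    leastFamily-unlearnable {Y} {n} n∉Y (M , learns) = gold (W φ) em M n
      (identifies (ray-ce acceptable n) (IsLeast-ray n))
      (λ m n≤m → identifies (interval-ce acceptable n m) (IsLeast-interval n≤m))
      where
      same : ∀ {i e} → IsLeast n (W φ e) → _∼_ (mergeLeast Y) i e → W φ i ≐ W φ e
      same l (inj₁ eq) = eq
      same l (inj₂ (k , k∈Y , _ , l′)) =
        contradiction (subst (_∈ Y) (IsLeast-unique l′ l) k∈Y) n∉Y

      identifies : ∀ {A} → ∃[ e ] A ≐ W φ e → IsLeast n A → Identifies (W φ) M A
      identifies (e , A≐W) l μ μ-enum =
        let l′ = IsLeast-resp A≐W l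
            i , i∼e , converges =
              learns e ((e , ≐-refl) , l′) μ (Enumerates-resp A≐W μ-enum)
        in i , ≐-trans (same l′ i∼e) (≐-sym A≐W) , converges

    -- A point `n` of `X` outside `Y` would make `leastFamily n` learnable for `X` and unlearnable
    -- for `Y`.
    mergeLeast-cancel : ∀ {X Y} → _≤Learn_ φ (mergeLeast X) (mergeLeast Y) → X ⊆ Y
    mergeLeast-cancel X≤Y {n} n∈X = em⇒dne em λ n∉Y →
      leastFamily-unlearnable n∉Y (X≤Y (leastFamily n) (leastFamily-learnable n∈X))

    𝒫ω-embedding : OrderEmbedding 𝒫ω (TLH φ)
    𝒫ω-embedding = mergeLeast , record
      { isOrderHomomorphism = record
        { cong = λ (X⊆Y , Y⊆X) → mergeLeast-mono X⊆Y , mergeLeast-mono Y⊆X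
        ; mono = mergeLeast-mono
        }
      ; injective = λ (X≤Y , Y≤X) → mergeLeast-cancel X≤Y , mergeLeast-cancel Y≤X
      ; cancel    = mergeLeast-cancel
      }

-- Binary strings

private
  -- `ℕᵇ` is bijective base two, so its numerals are exactly the finite binary strings. This
  -- identifies the subsets of 2^{<ω} with those of ω.
  bits : ℕᵇ → List Bool
  bits ℕᵇ.zero  = []
  bits 2[1+ x ] = true ∷ bits x
  bits 1+[2 x ] = false ∷ bits x

  unbits : List Bool → ℕᵇ
  unbits []          = ℕᵇ.zero
  unbits (true ∷ σ)  = 2[1+ unbits σ ]
  unbits (false ∷ σ) = 1+[2 unbits σ ]

  bits-unbits : ∀ σ → bits (unbits σ) ≡ σ
  bits-unbits []          = refl
  bits-unbits (true ∷ σ)  = cong (true ∷_) (bits-unbits σ)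
  bits-unbits (false ∷ σ) = cong (false ∷_) (bits-unbits σ)

string : ℕ → List Bool
string = bits ∘ ℕᵇ.fromℕ

code : List Bool → ℕ
code = ℕᵇ.toℕ ∘ unbits

string-code : ∀ σ → string (code σ) ≡ σ
string-code σ = trans (cong bits (fromℕ-toℕ (unbits σ))) (bits-unbits σ)

-- Every `σ` is the value of `string` at its code, so inclusion can be tested on preimages.
string-⊆-cancel : (P Q : Pred (List Bool) 0ℓ) → P ∘ string ⊆ Q ∘ string → P ⊆ Q
string-⊆-cancel P Q P⊆Q {σ} σ∈P =
  subst Q (string-code σ) (P⊆Q {code σ} (subst P (sym (string-code σ)) σ∈P))

-- Prefix sets and lexicographic cuts

Prefix : (ℕ → Bool) → Pred (List Bool) 0ℓ
Prefix b []      = ⊤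
Prefix b (x ∷ σ) = x ≡ b 0 × Prefix (b ∘ ℕ.suc) σ

Prefix-applyUpTo : ∀ b k → applyUpTo b k ∈ Prefix b
Prefix-applyUpTo b zero      = tt
Prefix-applyUpTo b (ℕ.suc k) = refl , Prefix-applyUpTo (b ∘ ℕ.suc) k

Prefix-cong : ∀ {b b′} → b ≗ b′ → Prefix b ⊆ Prefix b′
Prefix-cong b≗b′ {[]}    _         = tt
Prefix-cong b≗b′ {x ∷ σ} (eq , p) = trans eq (b≗b′ 0) , Prefix-cong (b≗b′ ∘ ℕ.suc) p

Prefix-agree : ∀ b b′ k → applyUpTo b (ℕ.suc k) ∈ Prefix b′ → b k ≡ b′ k
Prefix-agree b b′ zero      (eq , _) = eq
Prefix-agree b b′ (ℕ.suc k) (_ , p)  = Prefix-agree (b ∘ ℕ.suc) (b′ ∘ ℕ.suc) k p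

-- A sequence has only one prefix of each length, so a single inclusion already forces equality.
-- Hence distinct prefix sets are incomparable.
Prefix-⊆⇒≗ : ∀ b b′ → Prefix b ⊆ Prefix b′ → b ≗ b′
Prefix-⊆⇒≗ b b′ p⊆ k = Prefix-agree b b′ k (p⊆ (Prefix-applyUpTo b (ℕ.suc k)))

-- The prefixes of `b` are counted in its cut, which allows `b` to be recovered from it.
LexBelow : (ℕ → Bool) → Pred (List Bool) 0ℓ
LexBelow b []      = ⊤
LexBelow b (x ∷ σ) = x Bool.< b 0 ⊎ (x ≡ b 0 × LexBelow (b ∘ ℕ.suc) σ)

LexBelow-applyUpTo : ∀ b k → applyUpTo b k ∈ LexBelow b
LexBelow-applyUpTo b zero      = tt
LexBelow-applyUpTo b (ℕ.suc k) = inj₂ (refl , LexBelow-applyUpTo (b ∘ ℕ.suc) k)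

LexBelow-cong : ∀ {b b′} → b ≗ b′ → LexBelow b ⊆ LexBelow b′
LexBelow-cong b≗b′ {[]}    _                = tt
LexBelow-cong b≗b′ {x ∷ σ} (inj₁ x<b)       = inj₁ (subst (x Bool.<_) (b≗b′ 0) x<b)
LexBelow-cong b≗b′ {x ∷ σ} (inj₂ (eq , p)) =
  inj₂ (trans eq (b≗b′ 0) , LexBelow-cong (b≗b′ ∘ ℕ.suc) p)

-- At a first difference, the two memberships would demand strict inequalities in opposite
-- directions.
LexBelow-agree : ∀ b b′ k → applyUpTo b (ℕ.suc k) ∈ LexBelow b′ →
                 applyUpTo b′ (ℕ.suc k) ∈ LexBelow b → b k ≡ b′ k
LexBelow-agree b b′ k (inj₁ lt) (inj₁ gt)       = contradiction gt (Bool.<-asym lt)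
LexBelow-agree b b′ k (inj₁ lt) (inj₂ (eq , _)) = contradiction lt (Bool.<-irrefl (sym eq))
LexBelow-agree b b′ k (inj₂ (eq , _)) (inj₁ gt) = contradiction gt (Bool.<-irrefl (sym eq))
LexBelow-agree b b′ zero      (inj₂ (eq , _)) (inj₂ _)      = eq
LexBelow-agree b b′ (ℕ.suc k) (inj₂ (_ , p)) (inj₂ (_ , q)) =
  LexBelow-agree (b ∘ ℕ.suc) (b′ ∘ ℕ.suc) k p q

LexBelow-≐⇒≗ : ∀ b b′ → LexBelow b ≐ LexBelow b′ → b ≗ b′
LexBelow-≐⇒≗ b b′ (p⊆ , p⊇) k = LexBelow-agree b b′ k
  (p⊆ (LexBelow-applyUpTo b (ℕ.suc k))) (p⊇ (LexBelow-applyUpTo b′ (ℕ.suc k)))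

-- Compare first bits. If that of `b′` is smaller, everything below `b′` is below `b`; if they
-- agree, pass to the tails; if it is larger, then `σ`, being below `b`, would be below `b′`.
LexBelow-⊈⇒⊇ : ∀ {b b′} σ → σ ∈ LexBelow b → σ ∉ LexBelow b′ → LexBelow b′ ⊆ LexBelow b
LexBelow-⊈⇒⊇ [] _ σ∉ = contradiction tt σ∉
LexBelow-⊈⇒⊇ (x ∷ σ) σ∈ σ∉ {[]} _ = tt
LexBelow-⊈⇒⊇ {b} {b′} (x ∷ σ) σ∈ σ∉ {y ∷ τ} τ∈ with Bool.<-cmp (b′ 0) (b 0)
LexBelow-⊈⇒⊇ (x ∷ σ) σ∈ σ∉ (inj₁ y<b′) | tri< b′<b _ _ = inj₁ (Bool.<-trans y<b′ b′<b)
LexBelow-⊈⇒⊇ (x ∷ σ) σ∈ σ∉ (inj₂ (refl , _)) | tri< b′<b _ _ = inj₁ b′<b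
LexBelow-⊈⇒⊇ (x ∷ σ) (inj₁ x<b) σ∉ τ∈ | tri≈ _ b′≡b _ =
  contradiction (inj₁ (subst (x Bool.<_) (sym b′≡b) x<b)) σ∉
LexBelow-⊈⇒⊇ (x ∷ σ) (inj₂ _) σ∉ {y ∷ τ} (inj₁ y<b′) | tri≈ _ b′≡b _ =
  inj₁ (subst (y Bool.<_) b′≡b y<b′)
LexBelow-⊈⇒⊇ (x ∷ σ) (inj₂ (x≡b , p)) σ∉ (inj₂ (y≡b′ , q)) | tri≈ _ b′≡b _ =
  inj₂ (trans y≡b′ b′≡b ,
        LexBelow-⊈⇒⊇ σ p (λ p′ → σ∉ (inj₂ (trans x≡b (sym b′≡b) , p′))) q)
LexBelow-⊈⇒⊇ (x ∷ σ) (inj₁ x<b) σ∉ τ∈ | tri> _ _ b<b′ =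
  contradiction (inj₁ (Bool.<-trans x<b b<b′)) σ∉
LexBelow-⊈⇒⊇ (x ∷ σ) (inj₂ (refl , _)) σ∉ τ∈ | tri> _ _ b<b′ =
  contradiction (inj₁ b<b′) σ∉

LexBelow-total : ExcludedMiddle 0ℓ → ∀ b b′ →
                 LexBelow b ⊆ LexBelow b′ ⊎ LexBelow b′ ⊆ LexBelow b
LexBelow-total em b b′ with em {∃[ σ ] σ ∈ LexBelow b × σ ∉ LexBelow b′}
... | yes (σ , σ∈ , σ∉) = inj₂ (LexBelow-⊈⇒⊇ σ σ∈ σ∉)
... | no ¬∃             = inj₁ λ {σ} σ∈ → em⇒dne em λ σ∉ → ¬∃ (σ , σ∈ , σ∉)

-- Counting the two letters maps strings onto all pairs. Surjectivity of the resulting `unpair` lets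
-- a binary relation be read back from a single bit sequence.
counts : List Bool → ℕ × ℕ
counts []          = 0 , 0
counts (true ∷ σ)  = let m , n = counts σ in ℕ.suc m , n
counts (false ∷ σ) = let m , n = counts σ in m , ℕ.suc n

counts-surjective : ∀ m n → ∃[ σ ] counts σ ≡ (m , n)
counts-surjective zero zero = [] , refl
counts-surjective zero (ℕ.suc n) with σ , eq ← counts-surjective zero n =
  false ∷ σ , cong (λ (m , n) → m , ℕ.suc n) eq
counts-surjective (ℕ.suc m) n with σ , eq ← counts-surjective m n =
  true ∷ σ , cong (λ (m , n) → ℕ.suc m , n) eq

unpair : ℕ → ℕ × ℕ
unpair = counts ∘ string

unpair-surjective : ∀ m n → ∃[ k ] unpair k ≡ (m , n)
unpair-surjective m n with σ , eq ← counts-surjective m n =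
  code σ , trans (cong counts (string-code σ)) eq

-- Subsets and cardinality

module _ {c ℓ} (P : Poset c c ℓ) {κ : Setoid 0ℓ 0ℓ} (f : Injection κ (Poset.Eq.setoid P)) where
  open Poset P using (_≈_; module Eq; ≤-respˡ-≈; ≤-respʳ-≈) renaming (_≤_ to _⊑_)
  open Injection f using (to; injective) renaming (cong to to-cong)

  range : Subset P
  range = record
    { Member = λ x → ∃[ a ] to a ≈ x
    ; resp   = λ x≈y (a , fa≈x) → a , Eq.trans fa≈x x≈y
    }

  range-hasSize : HasSize P range κ
  range-hasSize = record
    { to        = λ a → to a , a , Eq.refl
    ; cong      = to-cong
    ; bijective = injective , λ (x , a , fa≈x) → a , λ b≈a → Eq.trans (to-cong b≈a) fa≈x
    }

  range-isChain : (∀ a b → to a ⊑ to b ⊎ to b ⊑ to a) → IsChain P range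
  range-isChain total (a , fa≈x) (b , fb≈y) = Sum.map
    (≤-respˡ-≈ fa≈x ∘ ≤-respʳ-≈ fb≈y) (≤-respˡ-≈ fb≈y ∘ ≤-respʳ-≈ fa≈x) (total a b)

  range-isAntichain : (∀ {a b} → to a ⊑ to b → to a ≈ to b) → IsAntichain P range
  range-isAntichain discrete (a , fa≈x) (b , fb≈y) x≉y (inj₁ x⊑y) = x≉y
    (Eq.trans (Eq.sym fa≈x) (Eq.trans
      (discrete (≤-respˡ-≈ (Eq.sym fa≈x) (≤-respʳ-≈ (Eq.sym fb≈y) x⊑y))) fb≈y))
  range-isAntichain discrete (a , fa≈x) (b , fb≈y) x≉y (inj₂ y⊑x) = x≉y
    (Eq.sym (Eq.trans (Eq.sym fb≈y) (Eq.trans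
      (discrete (≤-respˡ-≈ (Eq.sym fb≈y) (≤-respʳ-≈ (Eq.sym fa≈x) y⊑x))) fa≈x)))

-- Any competing bound `ν` receives an injection from the witness `A`, and `A` is in bijection with
-- `κ`.
attained⇒IsSupOfSizes : ∀ {c ℓ₁ ℓ₂ a ℓ q} {P : Poset c ℓ₁ ℓ₂} {κ : Setoid a ℓ}
  {Q : Subset P → Set q} → (∀ A → Injection (Subset.asSetoid A) κ) →
  (Σ[ A ∈ Subset P ] (Q A × HasSize P A κ)) → IsSupOfSizes P Q κ
attained⇒IsSupOfSizes bound (A , QA , size) =
  (λ B _ → bound B) , λ ν inj → Comp.injection (Bijection.injection size) (inj A QA)

does-⇔ : ∀ {a b} {A : Set a} {B : Set b} (A? : Dec A) (B? : Dec B) →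
         does A? ≡ does B? → A → B
does-⇔ _       (yes b) _  _ = b
does-⇔ (no ¬a) (no _)  _  a = contradiction a ¬a

-- The upper bound on the size of the hierarchy

module _ (em : ExcludedMiddle 0ℓ) (ac : AxiomOfChoice (suc 0ℓ) (suc 0ℓ)) (φ : Numbering) where
  open CERel

  private
    characteristic : CERel φ → ℕ → Bool
    characteristic E k = let d , e = unpair k in does (em {_∼_ E d e})

    characteristic-reflects : ∀ E F → characteristic E ≗ characteristic F →
                              ∀ {d e} → _∼_ E d e → _∼_ F d e
    characteristic-reflects E F E≗F {d} {e} with k , eq ← unpair-surjective d e =
      does-⇔ em em (subst (λ (d , e) → does (em {_∼_ E d e}) ≡ does (em {_∼_ F d e})) eq (E≗F k))

    characteristic⇒≈ : ∀ E F → characteristic E ≗ characteristic F → Poset._≈_ (TLH φ) E F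
    characteristic⇒≈ E F E≗F =
      finer⇒≤Learn φ E F (characteristic-reflects E F E≗F) ,
      finer⇒≤Learn φ F E (characteristic-reflects F E (sym ∘ E≗F))

  -- Choice picks a representative relation from each ≡Learn-class.
  TLH-bounded : (A : Subset (TLH φ)) → Injection (Subset.asSetoid A) 2^ℵ₀
  TLH-bounded A = record
    { to        = λ x → characteristic (proj₁ (to x))
    ; cong      = λ {x} {y} x≈y → lower (to-cong x≈y)
    ; injective = λ {x} {y} eq → ≈.trans (≈.sym (section x)) (≈.trans
                    (characteristic⇒≈ (proj₁ (to x)) (proj₁ (to y)) eq) (section y))
    }
    where
    T = Subset.asSetoid A
    module T = Setoid T
    module ≈ = Poset.Eq (TLH φ)

    -- `S` has the elements of `T` under the finer equality of having the same characteristic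
    -- function. The identity is then a surjection onto `T`, and splitting it chooses
    -- representatives in a way that respects `T`'s equality. `Lift` only adjusts the universe level
    -- to that of `ac`.
    S : Setoid (suc 0ℓ) (suc 0ℓ)
    S = record
      { Carrier       = T.Carrier
      ; _≈_           = λ x y → Lift (suc 0ℓ) (characteristic (proj₁ x) ≗ characteristic (proj₁ y))
      ; isEquivalence = record
        { refl  = lift λ _ → refl
        ; sym   = λ (lift p) → lift (sym ∘ p)
        ; trans = λ (lift p) (lift q) → lift λ k → trans (p k) (q k)
        }
      }

    forget : Surjection S T
    forget = record
      { to         = id
      ; cong       = λ {x} {y} (lift p) → characteristic⇒≈ (proj₁ x) (proj₁ y) p
      ; surjective = λ y → y , λ {z} (lift p) → characteristic⇒≈ (proj₁ z) (proj₁ y) p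
      }

    open Func (proj₁ (ac forget)) using (to) renaming (cong to to-cong)
    section = proj₂ (ac forget)

-- Antichain, chain, width and height

corollary4p4 : ExcludedMiddle (suc 0ℓ) → AxiomOfChoice (suc 0ℓ) (suc 0ℓ) →
    (φ : Numbering) → IsAcceptable φ →
    OrderEmbedding 𝒫ω (TLH φ)
    × (Σ[ A ∈ Subset (TLH φ) ] (IsAntichain (TLH φ) A × HasSize (TLH φ) A 2^ℵ₀))
    × (Σ[ C ∈ Subset (TLH φ) ] (IsChain (TLH φ) C × HasSize (TLH φ) C 2^ℵ₀))
    × IsWidth (TLH φ) 2^ℵ₀
    × IsHeight (TLH φ) 2^ℵ₀
corollary4p4 em ac φ acceptable =
  𝒫ω-embedding φ em₀ acceptable , antichain , chain ,
  attained⇒IsSupOfSizes bounded antichain , attained⇒IsSupOfSizes bounded chain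
  where
  em₀ : ExcludedMiddle 0ℓ
  em₀ = lower-em em

  bounded : (A : Subset (TLH φ)) → Injection (Subset.asSetoid A) 2^ℵ₀
  bounded = TLH-bounded em₀ ac φ

  mergeStrings : Pred (List Bool) 0ℓ → CERel φ
  mergeStrings P = mergeLeast φ (P ∘ string)

  mono : ∀ P Q → P ⊆ Q → _≤Learn_ φ (mergeStrings P) (mergeStrings Q)
  mono P Q P⊆Q = mergeLeast-mono φ λ {k} → P⊆Q {string k}

  cancel : ∀ P Q → _≤Learn_ φ (mergeStrings P) (mergeStrings Q) → P ⊆ Q
  cancel P Q P≤Q = string-⊆-cancel P Q λ {k} → mergeLeast-cancel φ em₀ acceptable P≤Q {k}

  -- Equality in `TLH` is mutual reducibility, so `P-injective` may use both inclusions. The cuts,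
  -- being comparable, rely on both.
  injection : (P : (ℕ → Bool) → Pred (List Bool) 0ℓ) →
              (∀ {b b′} → b ≗ b′ → P b ⊆ P b′) → (∀ b b′ → P b ≐ P b′ → b ≗ b′) →
              Injection 2^ℵ₀ (Poset.Eq.setoid (TLH φ))
  injection P P-cong P-injective = record
    { to        = mergeStrings ∘ P
    ; cong      = λ {b} {b′} b≗b′ →
        mono (P b) (P b′) (P-cong b≗b′) , mono (P b′) (P b) (P-cong (sym ∘ b≗b′))
    ; injective = λ {b} {b′} (b≤b′ , b′≤b) → P-injective b b′
        (cancel (P b) (P b′) b≤b′ , cancel (P b′) (P b) b′≤b)
    }

  prefixes cuts : Injection 2^ℵ₀ (Poset.Eq.setoid (TLH φ))
  prefixes = injection Prefix Prefix-cong (λ b b′ → Prefix-⊆⇒≗ b b′ ∘ proj₁)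
  cuts     = injection LexBelow LexBelow-cong LexBelow-≐⇒≗

  antichain : Σ[ A ∈ Subset (TLH φ) ] (IsAntichain (TLH φ) A × HasSize (TLH φ) A 2^ℵ₀)
  antichain = range (TLH φ) prefixes ,
    -- Reducibility between two prefix sets gives an inclusion, hence equal sequences, so comparable
    -- elements are equal.
    range-isAntichain (TLH φ) prefixes (λ {b} {b′} →
      Injection.cong prefixes ∘ Prefix-⊆⇒≗ b b′ ∘ cancel (Prefix b) (Prefix b′)) ,
    range-hasSize (TLH φ) prefixes

  chain : Σ[ C ∈ Subset (TLH φ) ] (IsChain (TLH φ) C × HasSize (TLH φ) C 2^ℵ₀)
  chain = range (TLH φ) cuts ,
    range-isChain (TLH φ) cuts (λ b b′ → Sum.map
      (mono (LexBelow b) (LexBelow b′)) (mono (LexBelow b′) (LexBelow b)) (LexBelow-total em₀ b b′)) ,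
    range-hasSize (TLH φ) cuts
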